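{- For every integer $m\ge 2$ and every integer $i$ with $1\le i\le m-1$, $$d_i^2(m)\bigl(d_i^2(m)-d_{i-1}(m)d_{i+1}(m)\bigr)>d_{i-1}^2(m)\bigl(d_{i+1}^2(m)-d_i(m)d_{i+2}(m)\bigr).$$
   Context: For integers $m\ge 0$ and $0\le i\le m$, the Boros–Moll numbers are $$d_i(m)=2^{ -2m}\sum_{k=i}^{m}2^k\binom{2m-2k}{m-k}\binom{m+k}{k}\binom{k}{i},$$ i.e. $d_i(m)$ is the coefficient of $x^i$ in $P_m(x)=2^{ -2m}\sum_{k=0}^m 2^k\binom{2m-2k}{m-k}\binom{m+k}{k}(x+1)^k$. By convention $d_i(m)=0$ for $i>m$ (consistent with the formula, since $\binom{k}{i}=0$ for $k<i$). -}

module Defs where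

open import Data.Nat.Base using (ℕ; suc; _+_; _*_; _∸_; _^_; NonZero)
open import Data.Nat.Properties using (m^n≢0)
open import Data.Nat.Combinatorics using (_C_)
open import Data.Integer.Base using (+_)
open import Data.List.Base using (applyUpTo)
open import Data.Nat.ListAction using (sum)
import Data.Rational.Base as ℚ
open ℚ using (ℚ)

infix 8 _²

_² : ℚ → ℚ
x ² = x ℚ.* x

-- Empty, hence 0, when b < a; so d i m below is 0 for i > m.
∑[_⋯_] : ℕ → ℕ → (ℕ → ℕ) → ℕ
∑[ a ⋯ b ] f = sum (applyUpTo (λ j → f (a + j)) (suc b ∸ a))

-- The Boros–Moll number d_i(m), the coefficient of x^i in
-- 2^{-2m} ∑_{k=0}^m 2^k C(2m-2k, m-k) C(m+k, k) (x+1)^k.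
-- The truncated subtractions are exact, since k ≤ m throughout the sum.
d : ℕ → ℕ → ℚ
d i m = (+ ∑[ i ⋯ m ] (λ k →
           2 ^ k * ((2 * m ∸ 2 * k) C (m ∸ k)) * ((m + k) C k) * (k C i)))
        ℚ./ (2 ^ (2 * m))
  where
  instance
    2^2m≢0 : NonZero (2 ^ (2 * m))
    2^2m≢0 = m^n≢0 2 (2 * m)

{-# OPTIONS --safe #-}

-- The scaled numbers A_i = 4^m d_i(m) are natural and satisfy a three-term recurrence in i,
--   (m - i + 1)(m + i) A_{i-1} + i (i + 1) A_{i+1} = i (2m + 1) A_i,
-- obtained by telescoping the defining sum over k.  Running it downwards from A_{m+1} = 0 gives
--   2 i (m - i) / ((2i + 1)(i + 1)) ≤ A_{i+1} / A_i ≤ (m - i) / (i + 1).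
-- Write p, q, r, s for A_{i-1}, …, A_{i+2}.  The recurrence eliminates p and s, and the two
-- bounds then yield log-concavity p r < q² and convexity of the successive ratios,
-- q/p + s/r ≥ 2 r/q.  Convexity says p (r² - q s) ≤ r (q² - p r), whence
--   p² (r² - q s) ≤ p r (q² - p r) < q² (q² - p r).
module Submission where

open import Defs
open import Data.Nat.Base using (ℕ; _+_; _∸_; _≤_)

open import Data.List.Base using ([]; _∷_; _∷ʳ_; applyUpTo)
open import Data.List.Properties using (applyUpTo-∷ʳ)
open import Data.Nat.Base as ℕ using (suc; s≤s; NonZero)
open import Data.Nat.Combinatorics using (_C_; nC1≡n; nCk≡nC[n∸k]; k>n⇒nCk≡0; nCk+nC[k+1]≡[n+1]C[k+1])
open import Data.Nat.ListAction using (sum)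
open import Data.Nat.ListAction.Properties using (sum-++)
import Data.Nat.Properties as ℕ
open import Function.Base using (_∘_)
open import Relation.Binary.PropositionalEquality

module Naturals where
  open import Algebra.Properties.CommutativeSemigroup ℕ.+-commutativeSemigroup using (interchange; xy∙z≈xz∙y; xy∙z≈x∙zy)
  open import Data.Nat.Tactic.RingSolver using (solve-∀)
  open import Data.Nat.Base
  open import Data.Nat.Properties

  -- Finite sums and telescoping.

  sum-applyUpTo-suc : ∀ f n → sum (applyUpTo f (suc n)) ≡ sum (applyUpTo f n) + f n
  sum-applyUpTo-suc f n = begin
    sum (applyUpTo f (suc n))             ≡⟨ cong sum (applyUpTo-∷ʳ f n) ⟨
    sum (applyUpTo f n ∷ʳ f n)            ≡⟨ sum-++ (applyUpTo f n) (f n ∷ []) ⟩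
    sum (applyUpTo f n) + (f n + 0)       ≡⟨ cong (sum (applyUpTo f n) +_) (+-identityʳ (f n)) ⟩
    sum (applyUpTo f n) + f n             ∎
    where open ≡-Reasoning

  -- The sum in `d i m` starts at k = i, whereas `scaled` starts at 0 for every i, so that sums with
  -- different i combine termwise. Vanishing initial terms bridge the two.
  sum-applyUpTo-skip : ∀ f i n → (∀ k → k < i → f k ≡ 0) →
    sum (applyUpTo f (i + n)) ≡ sum (applyUpTo (λ j → f (i + j)) n)
  sum-applyUpTo-skip f zero    n f≡0 = refl
  sum-applyUpTo-skip f (suc i) n f≡0 = begin
    f 0 + sum (applyUpTo (f ∘ suc) (i + n))      ≡⟨ cong (_+ sum (applyUpTo (f ∘ suc) (i + n))) (f≡0 0 z<s) ⟩
    sum (applyUpTo (f ∘ suc) (i + n))            ≡⟨ sum-applyUpTo-skip (f ∘ suc) i n (λ k k<i → f≡0 (suc k) (s<s k<i)) ⟩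
    sum (applyUpTo (λ j → f (suc i + j)) n)      ∎
    where open ≡-Reasoning

  sum-applyUpTo-*ˡ : ∀ c f n → c * sum (applyUpTo f n) ≡ sum (applyUpTo (λ k → c * f k) n)
  sum-applyUpTo-*ˡ c f zero    = *-zeroʳ c
  sum-applyUpTo-*ˡ c f (suc n) =
    trans (*-distribˡ-+ c (f 0) _) (cong (c * f 0 +_) (sum-applyUpTo-*ˡ c (f ∘ suc) n))

  sum-applyUpTo-+ : ∀ f g n →
    sum (applyUpTo f n) + sum (applyUpTo g n) ≡ sum (applyUpTo (λ k → f k + g k) n)
  sum-applyUpTo-+ f g zero    = refl
  sum-applyUpTo-+ f g (suc n) = begin
    (f 0 + F) + (g 0 + G)   ≡⟨ interchange (f 0) F (g 0) G ⟩
    (f 0 + g 0) + (F + G)   ≡⟨ cong (f 0 + g 0 +_) (sum-applyUpTo-+ (f ∘ suc) (g ∘ suc) n) ⟩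
    (f 0 + g 0) + sum (applyUpTo (λ k → f (suc k) + g (suc k)) n) ∎
    where
    open ≡-Reasoning
    F = sum (applyUpTo (f ∘ suc) n)
    G = sum (applyUpTo (g ∘ suc) n)

  -- Every negative term of ∑ (f k - g k) = t n - t 0 is moved across, because subtraction on ℕ
  -- truncates.
  telescope : ∀ (f g t : ℕ → ℕ) n → (∀ k → k < n → f k + t k ≡ g k + t (suc k)) →
    sum (applyUpTo f n) + t 0 ≡ sum (applyUpTo g n) + t n
  telescope f g t zero    step = refl
  telescope f g t (suc n) step = begin
    (f 0 + F) + t 0         ≡⟨ xy∙z≈xz∙y (f 0) F (t 0) ⟩
    (f 0 + t 0) + F         ≡⟨ cong (_+ F) (step 0 z<s) ⟩
    (g 0 + t 1) + F         ≡⟨ xy∙z≈x∙zy (g 0) (t 1) F ⟩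
    g 0 + (F + t 1)         ≡⟨ cong (g 0 +_) (telescope (f ∘ suc) (g ∘ suc) (t ∘ suc) n (λ k k<n → step (suc k) (s<s k<n))) ⟩
    g 0 + (G + t (suc n))   ≡⟨ +-assoc (g 0) G _ ⟨
    (g 0 + G) + t (suc n)   ∎
    where
    open ≡-Reasoning
    F = sum (applyUpTo (f ∘ suc) n)
    G = sum (applyUpTo (g ∘ suc) n)

  -- Binomial coefficient identities.

  [k+1]*[n+1]C[k+1]≡[n+1]*nCk : ∀ n k → suc k * (suc n C suc k) ≡ suc n * (n C k)
  [k+1]*[n+1]C[k+1]≡[n+1]*nCk zero zero = refl
  [k+1]*[n+1]C[k+1]≡[n+1]*nCk zero (suc k) =
    trans (cong (suc (suc k) *_) (k>n⇒nCk≡0 {1} {suc (suc k)} (s<s z<s)))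
          (trans (*-zeroʳ (suc (suc k))) (sym (trans (*-identityˡ (0 C suc k)) (k>n⇒nCk≡0 {0} {suc k} z<s))))
  [k+1]*[n+1]C[k+1]≡[n+1]*nCk (suc n) zero =
    trans (*-identityˡ _) (trans (nC1≡n (suc (suc n))) (sym (*-identityʳ _)))
  [k+1]*[n+1]C[k+1]≡[n+1]*nCk (suc n) (suc k) = begin
    suc (suc k) * (suc (suc n) C suc (suc k))
      ≡⟨ cong (suc (suc k) *_) (nCk+nC[k+1]≡[n+1]C[k+1] (suc n) (suc k)) ⟨
    suc (suc k) * (X + Y)
      -- One copy of X is set aside, so that both remaining products fall under the induction
      -- hypothesis.
      ≡⟨ expand k X Y ⟩
    (suc k * X + suc (suc k) * Y) + X
      ≡⟨ cong₂ (λ x y → (x + y) + X) ([k+1]*[n+1]C[k+1]≡[n+1]*nCk n k) ([k+1]*[n+1]C[k+1]≡[n+1]*nCk n (suc k)) ⟩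
    (suc n * (n C k) + suc n * (n C suc k)) + X
      ≡⟨ cong (_+ X) (*-distribˡ-+ (suc n) (n C k) (n C suc k)) ⟨
    suc n * (n C k + n C suc k) + X
      ≡⟨ cong (λ x → suc n * x + X) (nCk+nC[k+1]≡[n+1]C[k+1] n k) ⟩
    suc n * X + X
      ≡⟨ +-comm (suc n * X) X ⟩
    suc (suc n) * X ∎
    where
    open ≡-Reasoning
    X = suc n C suc k
    Y = suc n C suc (suc k)
    expand : ∀ k x y → suc (suc k) * (x + y) ≡ (suc k * x + suc (suc k) * y) + x
    expand = solve-∀

  -- Subtraction-free form of (k + 1) C(n, k + 1) = (n - k) C(n, k): absorption on row n + 1,
  -- expanded by Pascal's rule, with one copy of C(n, k) cancelled.
  [k+1]*nC[k+1]+k*nCk≡n*nCk : ∀ n k → suc k * (n C suc k) + k * (n C k) ≡ n * (n C k)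
  [k+1]*nC[k+1]+k*nCk≡n*nCk n k = +-cancelˡ-≡ X _ _ (begin
    X + (suc k * Y + k * X)   ≡⟨ collect k X Y ⟩
    suc k * (X + Y)           ≡⟨ cong (suc k *_) (nCk+nC[k+1]≡[n+1]C[k+1] n k) ⟩
    suc k * (suc n C suc k)   ≡⟨ [k+1]*[n+1]C[k+1]≡[n+1]*nCk n k ⟩
    suc n * X                 ∎)
    where
    open ≡-Reasoning
    X = n C k
    Y = n C suc k
    collect : ∀ k x y → x + (suc k * y + k * x) ≡ suc k * (x + y)
    collect = solve-∀

  -- Absorption is applied twice, linked by the symmetry of the two middle entries of row 2n + 1.
  -- The additional factor n + 1, cancelled at the end, makes the second application possible.
  [n+1]*centralBinomial : ∀ n →
    suc n * ((2 * suc n) C suc n) ≡ 2 * (2 * n + 1) * ((2 * n) C n)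
  [n+1]*centralBinomial n = *-cancelˡ-≡ _ _ (suc n) (begin
    suc n * (suc n * ((2 * suc n) C suc n))
      ≡⟨ cong (λ x → suc n * (suc n * (x C suc n))) (*-suc 2 n) ⟩
    suc n * (suc n * (suc (suc (2 * n)) C suc n))
      ≡⟨ cong (suc n *_) ([k+1]*[n+1]C[k+1]≡[n+1]*nCk (suc (2 * n)) n) ⟩
    suc n * (suc (suc (2 * n)) * (suc (2 * n) C n))
      ≡⟨ cong (λ x → suc n * (suc (suc (2 * n)) * x)) symm ⟩
    suc n * (suc (suc (2 * n)) * (suc (2 * n) C suc n))
      ≡⟨ rearr n (suc (2 * n) C suc n) ⟩
    suc (suc (2 * n)) * (suc n * (suc (2 * n) C suc n))
      ≡⟨ cong (suc (suc (2 * n)) *_) ([k+1]*[n+1]C[k+1]≡[n+1]*nCk (2 * n) n) ⟩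
    suc (suc (2 * n)) * (suc (2 * n) * ((2 * n) C n))
      ≡⟨ rearr′ n ((2 * n) C n) ⟩
    suc n * (2 * (2 * n + 1) * ((2 * n) C n)) ∎)
    where
    open ≡-Reasoning
    rearr : ∀ n x → suc n * (suc (suc (2 * n)) * x) ≡ suc (suc (2 * n)) * (suc n * x)
    rearr = solve-∀
    rearr′ : ∀ n x → suc (suc (2 * n)) * (suc (2 * n) * x) ≡ suc n * (2 * (2 * n + 1) * x)
    rearr′ = solve-∀
    symm : suc (2 * n) C n ≡ suc (2 * n) C suc n
    symm = begin
      suc (2 * n) C n
        ≡⟨ nCk≡nC[n∸k] (m≤n⇒m≤1+n (m≤m+n n _)) ⟩
      suc (2 * n) C (suc (2 * n) ∸ n)
        ≡⟨ cong (suc (2 * n) C_) (trans (cong (λ x → suc (n + x) ∸ n) (+-identityʳ n)) (m+n∸n≡m (suc n) n)) ⟩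
      suc (2 * n) C suc n ∎

  -- The three-term recurrence in i.

  weight : ℕ → ℕ → ℕ
  weight m k = 2 ^ k * ((2 * m ∸ 2 * k) C (m ∸ k)) * ((m + k) C k)

  weight-k+a : ∀ k a → weight (k + a) k ≡ 2 ^ k * ((2 * a) C a) * ((k + a + k) C k)
  weight-k+a k a = cong (λ x → 2 ^ k * x * ((k + a + k) C k))
    (cong₂ _C_ (trans (sym (*-distribˡ-∸ 2 (k + a) k)) (cong (2 *_) (m+n∸m≡n k a))) (m+n∸m≡n k a))

  -- The quotient of consecutive weights, cleared of denominators: with a + 1 = m - k it is (m -
  -- k)(m + k + 1) / ((2(m - k) - 1)(k + 1)). The factors come from the central binomial ratio and
  -- from absorption in C(m + k, k).
  weight-step : ∀ k a → let m = k + suc a in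
    weight m k * (suc a * suc (m + k)) ≡ weight m (suc k) * ((2 * a + 1) * suc k)
  weight-step k a = begin
    weight m k * (suc a * suc (m + k))
      ≡⟨ cong (_* (suc a * suc (m + k))) (weight-k+a k (suc a)) ⟩
    2 ^ k * ((2 * suc a) C suc a) * ((m + k) C k) * (suc a * suc (m + k))
      ≡⟨ regroup (2 ^ k) ((2 * suc a) C suc a) ((m + k) C k) (suc a) (suc (m + k)) ⟩
    2 ^ k * (suc a * ((2 * suc a) C suc a)) * (suc (m + k) * ((m + k) C k))
      ≡⟨ cong₂ (λ x y → 2 ^ k * x * y) ([n+1]*centralBinomial a) (sym ([k+1]*[n+1]C[k+1]≡[n+1]*nCk (m + k) k)) ⟩
    2 ^ k * (2 * (2 * a + 1) * ((2 * a) C a)) * (suc k * (suc (m + k) C suc k))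
      ≡⟨ regroup′ (2 ^ k) (2 * a + 1) ((2 * a) C a) (suc k) (suc (m + k) C suc k) ⟩
    2 ^ suc k * ((2 * a) C a) * (suc (m + k) C suc k) * ((2 * a + 1) * suc k)
      ≡⟨ cong (λ x → 2 ^ suc k * ((2 * a) C a) * (x C suc k) * ((2 * a + 1) * suc k))
           (trans (sym (+-suc m k)) (cong (_+ suc k) (+-suc k a))) ⟩
    2 ^ suc k * ((2 * a) C a) * ((suc k + a + suc k) C suc k) * ((2 * a + 1) * suc k)
      ≡⟨ cong (_* ((2 * a + 1) * suc k)) (weight-k+a (suc k) a) ⟨
    weight (suc k + a) (suc k) * ((2 * a + 1) * suc k)
      ≡⟨ cong (λ x → weight x (suc k) * ((2 * a + 1) * suc k)) (+-suc k a) ⟨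
    weight m (suc k) * ((2 * a + 1) * suc k) ∎
    where
    open ≡-Reasoning
    m = k + suc a
    regroup : ∀ w x y a b → w * x * y * (a * b) ≡ w * (a * x) * (b * y)
    regroup = solve-∀
    regroup′ : ∀ w b x c y → w * (2 * b * x) * (c * y) ≡ 2 * w * x * y * (b * c)
    regroup′ = solve-∀

  -- The recurrence for a single k after division by the weight, where e = m - j and a = m - k. The
  -- last summand on each side is the contribution of the telescoping term, at k on the left and at
  -- k + 1 on the right.
  binomial-identity : ∀ k j a e → e + j ≡ k + a → let m = k + a in
    e * (m + j + 1) * (k C j) + suc j * suc (suc j) * (k C (2 + j)) + (2 * a + 1) * (suc j * (k C (1 + j)))
    ≡ (2 * m + 1) * (suc j * (k C (1 + j))) + a * suc (m + k) * (k C j)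
  -- The added summand lets the relation between adjacent binomials be used at columns j + 1 and j
  -- without subtraction.
  binomial-identity k j a e e+j≡m = +-cancelʳ-≡ (suc j * Y + (k + j + 1) * (j * X)) _ _ (begin
    e * (m + j + 1) * X + suc j * suc (suc j) * Z + (2 * a + 1) * (suc j * Y₀) + (suc j * Y + (k + j + 1) * (j * X))
      ≡⟨ lhs k j a e m X Y₀ Z ⟩
    (e * (m + j + 1) + j * suc j) * X + suc j * (suc (suc j) * Z + suc j * Y₀) + (2 * a + 1) * Y + k * j * X
      ≡⟨ cong₂ (λ x y → x * X + suc j * y + (2 * a + 1) * Y + k * j * X) (square e j m e+j≡m)
           ([k+1]*nC[k+1]+k*nCk≡n*nCk k (suc j)) ⟩
    m * (m + 1) * X + suc j * (k * Y₀) + (2 * a + 1) * Y + k * j * X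
      ≡⟨ mid k j a X Y₀ ⟩
    k * Y + (2 * a + 1) * Y + (k + j + 1) * (k * X) + a * suc (m + k) * X
      ≡⟨ cong (λ x → k * Y + (2 * a + 1) * Y + (k + j + 1) * x + a * suc (m + k) * X)
           ([k+1]*nC[k+1]+k*nCk≡n*nCk k j) ⟨
    k * Y + (2 * a + 1) * Y + (k + j + 1) * (Y + j * X) + a * suc (m + k) * X
      ≡⟨ rhs k j a X Y₀ ⟩
    (2 * m + 1) * (suc j * Y₀) + a * suc (m + k) * X + (suc j * Y + (k + j + 1) * (j * X)) ∎)
    where
    open ≡-Reasoning
    m = k + a
    X = k C j
    Y₀ = k C suc j
    Y = suc j * Y₀
    Z = k C suc (suc j)
    -- (m - j)(m + j + 1) = m(m + 1) - j(j + 1), which eliminates e.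
    square : ∀ e j m → e + j ≡ m → e * (m + j + 1) + j * suc j ≡ m * (m + 1)
    square e j _ refl = poly e j
      where
      poly : ∀ e j → e * (e + j + j + 1) + j * suc j ≡ (e + j) * (e + j + 1)
      poly = solve-∀
    lhs : ∀ k j a e m X Y Z →
      e * (m + j + 1) * X + suc j * suc (suc j) * Z + (2 * a + 1) * (suc j * Y) + (suc j * (suc j * Y) + (k + j + 1) * (j * X))
      ≡ (e * (m + j + 1) + j * suc j) * X + suc j * (suc (suc j) * Z + suc j * Y) + (2 * a + 1) * (suc j * Y) + k * j * X
    lhs = solve-∀
    mid : ∀ k j a X Y →
      (k + a) * (k + a + 1) * X + suc j * (k * Y) + (2 * a + 1) * (suc j * Y) + k * j * X
      ≡ k * (suc j * Y) + (2 * a + 1) * (suc j * Y) + (k + j + 1) * (k * X) + a * suc (k + a + k) * X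
    mid = solve-∀
    rhs : ∀ k j a X Y →
      k * (suc j * Y) + (2 * a + 1) * (suc j * Y) + (k + j + 1) * (suc j * Y + j * X) + a * suc (k + a + k) * X
      ≡ (2 * (k + a) + 1) * (suc j * Y) + a * suc (k + a + k) * X + (suc j * (suc j * Y) + (k + j + 1) * (j * X))
    rhs = solve-∀

  term : ℕ → ℕ → ℕ → ℕ
  term m i k = weight m k * (k C i)

  -- 4^m d_i(m)
  scaled : ℕ → ℕ → ℕ
  scaled m i = sum (applyUpTo (term m i) (suc m))

  -- Each summand satisfies the recurrence up to a telescoping difference in k, in the manner of
  -- Zeilberger. The recurrence is centred at i = j + 1, and e = m - j is an argument so that no
  -- subtraction occurs.
  scaled-recurrence : ∀ {m} e j → e + j ≡ m →
    e * (m + j + 1) * scaled m j + suc j * suc (suc j) * scaled m (2 + j)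
    ≡ (2 * m + 1) * suc j * scaled m (1 + j)
  scaled-recurrence {m} e j e+j≡m = begin
    e * (m + j + 1) * scaled m j + suc j * suc (suc j) * scaled m (2 + j)
      ≡⟨ cong₂ _+_ (sum-applyUpTo-*ˡ (e * (m + j + 1)) (term m j) (suc m)) (sum-applyUpTo-*ˡ (suc j * suc (suc j)) (term m (2 + j)) (suc m)) ⟩
    sum (applyUpTo f₁ (suc m)) + sum (applyUpTo f₂ (suc m))
      ≡⟨ sum-applyUpTo-+ f₁ f₂ (suc m) ⟩
    sum (applyUpTo f (suc m))
      -- The summand k = m is split off: `t` does not vanish at m + 1, where truncated subtraction
      -- replaces negative numbers by 0. `last` pairs it with `t m` instead.
      ≡⟨ sum-applyUpTo-suc f m ⟩
    sum (applyUpTo f m) + f m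
      ≡⟨ cong (_+ f m) (trans (sym (+-identityʳ _)) (trans (cong (sum (applyUpTo f m) +_) (sym t0≡0)) (telescope f g t m step))) ⟩
    sum (applyUpTo g m) + t m + f m
      ≡⟨ +-assoc (sum (applyUpTo g m)) (t m) (f m) ⟩
    sum (applyUpTo g m) + (t m + f m)
      ≡⟨ cong (sum (applyUpTo g m) +_) (trans (+-comm (t m) (f m)) last) ⟩
    sum (applyUpTo g m) + g m
      ≡⟨ sum-applyUpTo-suc g m ⟨
    sum (applyUpTo g (suc m))
      ≡⟨ sum-applyUpTo-*ˡ ((2 * m + 1) * suc j) (term m (1 + j)) (suc m) ⟨
    (2 * m + 1) * suc j * scaled m (1 + j) ∎
    where
    open ≡-Reasoning
    f₁ f₂ f g t : ℕ → ℕ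
    f₁ k = e * (m + j + 1) * term m j k
    f₂ k = suc j * suc (suc j) * term m (2 + j) k
    f k = f₁ k + f₂ k
    g k = (2 * m + 1) * suc j * term m (1 + j) k
    -- The telescoping certificate, zero at k = 0 since C(0, j + 1) = 0.
    t k = weight m k * ((2 * (m ∸ k) + 1) * (suc j * (k C (1 + j))))

    t0≡0 : t 0 ≡ 0
    t0≡0 = begin
      t 0 ≡⟨ cong (λ x → weight m 0 * ((2 * m + 1) * (suc j * x))) (k>n⇒nCk≡0 {0} {suc j} z<s) ⟩
      weight m 0 * ((2 * m + 1) * (suc j * 0)) ≡⟨ vanish (weight m 0) m j ⟩
      0 ∎
      where
      vanish : ∀ w m j → w * ((2 * m + 1) * (suc j * 0)) ≡ 0
      vanish = solve-∀

    -- With a = m - k, the leftover is zero for k = m, and for k < m `weight-step` and absorption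
    -- turn it into `t (suc k)`.
    local : ∀ k a → m ≡ k + a →
      f k + t k ≡ g k + weight m k * (a * suc (m + k) * (k C j))
    local k a m≡k+a = begin
      f k + t k
        ≡⟨ cong (λ x → f k + weight m k * ((2 * x + 1) * (suc j * (k C (1 + j)))))
             (trans (cong (_∸ k) m≡k+a) (m+n∸m≡n k a)) ⟩
      f k + weight m k * ((2 * a + 1) * (suc j * (k C (1 + j))))
        ≡⟨ factor (weight m k) (e * (m + j + 1)) (k C j) (suc j * suc (suc j)) (k C (2 + j)) _ ⟩
      weight m k * (e * (m + j + 1) * (k C j) + suc j * suc (suc j) * (k C (2 + j)) + (2 * a + 1) * (suc j * (k C (1 + j))))
        ≡⟨ cong (weight m k *_) (subst (λ n → e * (n + j + 1) * (k C j) + suc j * suc (suc j) * (k C (2 + j)) + (2 * a + 1) * (suc j * (k C (1 + j)))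
             ≡ (2 * n + 1) * (suc j * (k C (1 + j))) + a * suc (n + k) * (k C j)) (sym m≡k+a) (binomial-identity k j a e (trans e+j≡m m≡k+a))) ⟩
      weight m k * ((2 * m + 1) * (suc j * (k C (1 + j))) + a * suc (m + k) * (k C j))
        ≡⟨ unfactor (weight m k) (2 * m + 1) (suc j) (k C (1 + j)) _ ⟩
      g k + weight m k * (a * suc (m + k) * (k C j)) ∎
      where
      factor : ∀ w a x b y z → a * (w * x) + b * (w * y) + w * z ≡ w * (a * x + b * y + z)
      factor = solve-∀
      unfactor : ∀ w a b x y → w * (a * (b * x) + y) ≡ a * b * (w * x) + w * y
      unfactor = solve-∀

    last : f m + t m ≡ g m
    last = trans (local m 0 (sym (+-identityʳ m))) (trans (cong (g m +_) (*-zeroʳ (weight m m))) (+-identityʳ (g m)))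

    step : ∀ k → k < m → f k + t k ≡ g k + t (suc k)
    step k k<m = trans (local k (suc a) m≡k+1+a) (cong (g k +_) (begin
      weight m k * (suc a * suc (m + k) * (k C j))
        ≡⟨ *-assoc (weight m k) _ _ ⟨
      weight m k * (suc a * suc (m + k)) * (k C j)
        ≡⟨ cong (_* (k C j)) (subst (λ n → weight n k * (suc a * suc (n + k)) ≡ weight n (suc k) * ((2 * a + 1) * suc k)) (sym m≡k+1+a) (weight-step k a)) ⟩
      weight m (suc k) * ((2 * a + 1) * suc k) * (k C j)
        ≡⟨ regroup (weight m (suc k)) (2 * a + 1) (suc k) (k C j) ⟩
      weight m (suc k) * ((2 * a + 1) * (suc k * (k C j)))
        ≡⟨ cong (λ x → weight m (suc k) * ((2 * a + 1) * x)) ([k+1]*[n+1]C[k+1]≡[n+1]*nCk k j) ⟨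
      t (suc k) ∎))
      where
      a = m ∸ suc k
      m≡k+1+a : m ≡ k + suc a
      m≡k+1+a = trans (sym (m+[n∸m]≡n k<m)) (sym (+-suc k a))
      regroup : ∀ w x y z → w * (x * y) * z ≡ w * (x * (y * z))
      regroup = solve-∀

  -- Boundary values, positivity and bounds on consecutive ratios.

  k≤n⇒0<nCk : ∀ {n k} → k ≤ n → 0 < n C k
  k≤n⇒0<nCk z≤n = z<s
  k≤n⇒0<nCk {suc n} {suc k} (s≤s k≤n) =
    subst (0 <_) (nCk+nC[k+1]≡[n+1]C[k+1] n k) (<-≤-trans (k≤n⇒0<nCk k≤n) (m≤m+n _ _))

  term-below : ∀ m i k → k < i → term m i k ≡ 0
  term-below m i k k<i = trans (cong (weight m k *_) (k>n⇒nCk≡0 k<i)) (*-zeroʳ (weight m k))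

  scaled-above : ∀ m → scaled m (suc m) ≡ 0
  scaled-above m = begin
    sum (applyUpTo (term m (suc m)) (suc m))      ≡⟨ cong (λ n → sum (applyUpTo (term m (suc m)) n)) (+-identityʳ (suc m)) ⟨
    sum (applyUpTo (term m (suc m)) (suc m + 0))  ≡⟨ sum-applyUpTo-skip (term m (suc m)) (suc m) 0 (term-below m (suc m)) ⟩
    0 ∎
    where open ≡-Reasoning

  scaled-diagonal : ∀ m → 0 < scaled m m
  scaled-diagonal m = begin-strict
    0                                  <⟨ *-mono-< (*-mono-< (*-mono-< (m^n>0 2 m) central) (k≤n⇒0<nCk (m≤n+m m m))) (k≤n⇒0<nCk (≤-refl {m})) ⟩
    term m m m                         ≤⟨ m≤n+m (term m m m) _ ⟩
    sum (applyUpTo (term m m) m) + term m m m ≡⟨ sum-applyUpTo-suc (term m m) m ⟨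
    scaled m m                         ∎
    where
    open ≤-Reasoning
    central : 0 < (2 * m ∸ 2 * m) C (m ∸ m)
    central = k≤n⇒0<nCk (≤-reflexive (trans (n∸n≡0 m) (sym (n∸n≡0 (2 * m)))))

  -- Inserting the bound on r into the recurrence bounds p from below. With i = j + 1, h = m - i and
  -- c = m + i, one has 2m + 1 = c + h + 1, so a surplus of i q is left over.
  ratio-upper-step : ∀ {m} j h p q r → h + suc j ≡ m →
    suc h * (m + j + 1) * p + suc j * suc (suc j) * r ≡ (2 * m + 1) * suc j * q →
    suc (suc j) * r ≤ h * q → suc j * q ≤ suc h * p
  ratio-upper-step j h p q r refl rec r≤q = *-cancelˡ-≤ c {{c≢0}}
    (+-cancelʳ-≤ (suc j * (suc (suc j) * r)) _ _ (begin
      c * (suc j * q) + suc j * (suc (suc j) * r)  ≤⟨ +-monoʳ-≤ (c * (suc j * q)) (*-monoʳ-≤ (suc j) r≤q) ⟩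
      c * (suc j * q) + suc j * (h * q)            ≤⟨ m≤m+n _ (suc j * q) ⟩
      c * (suc j * q) + suc j * (h * q) + suc j * q ≡⟨ poly₁ j h q ⟩
      (2 * (h + suc j) + 1) * suc j * q            ≡⟨ rec ⟨
      suc h * c * p + suc j * suc (suc j) * r      ≡⟨ poly₂ (suc h) c p (suc j) (suc (suc j)) r ⟩
      c * (suc h * p) + suc j * (suc (suc j) * r)  ∎))
    where
    open ≤-Reasoning
    c = h + suc j + j + 1
    c≢0 : NonZero c
    c≢0 = >-nonZero (m≤n+m 1 (h + suc j + j))
    poly₁ : ∀ j h q → (h + suc j + j + 1) * (suc j * q) + suc j * (h * q) + suc j * q ≡ (2 * (h + suc j) + 1) * suc j * q
    poly₁ = solve-∀
    poly₂ : ∀ h c p a b r → h * c * p + a * b * r ≡ c * (h * p) + a * (b * r)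
    poly₂ = solve-∀

  -- The dual step: a lower bound on r bounds p from above. The factor b = 2i + 1 clears the
  -- denominator of the assumed bound.
  ratio-lower-step : ∀ {m} j h p q r → h + suc j ≡ m →
    suc h * (m + j + 1) * p + suc j * suc (suc j) * r ≡ (2 * m + 1) * suc j * q →
    2 * suc j * h * q ≤ (2 * suc j + 1) * suc (suc j) * r →
    2 * j * suc h * p ≤ (2 * j + 1) * suc j * q
  ratio-lower-step j h p q r refl rec q≤r = *-cancelˡ-≤ (b * c) {{m*n≢0 b c {{_}} {{c≢0}}}}
    (+-cancelʳ-≤ (2 * j * suc j * (b * suc (suc j) * r)) _ _ (begin
      b * c * (2 * j * suc h * p) + 2 * j * suc j * (b * suc (suc j) * r)
        ≡⟨ poly₁ b c (2 * j) (suc h) p (suc j) (suc (suc j)) r ⟩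
      2 * j * b * (suc h * c * p + suc j * suc (suc j) * r)
        ≡⟨ cong (2 * j * b *_) rec ⟩
      2 * j * b * ((2 * (h + suc j) + 1) * suc j * q)
        ≤⟨ m≤m+n _ _ ⟩
      -- The added multiple of q is exactly the slack that remains once the assumed bound is
      -- substituted.
      2 * j * b * ((2 * (h + suc j) + 1) * suc j * q) + suc j * (4 * j + 6 + 3 * h) * q
        ≡⟨ poly₂ j h q ⟩
      b * c * ((2 * j + 1) * suc j * q) + 2 * j * suc j * (2 * suc j * h * q)
        ≤⟨ +-monoʳ-≤ (b * c * ((2 * j + 1) * suc j * q)) (*-monoʳ-≤ (2 * j * suc j) q≤r) ⟩
      b * c * ((2 * j + 1) * suc j * q) + 2 * j * suc j * (b * suc (suc j) * r) ∎))
    where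
    open ≤-Reasoning
    b = 2 * suc j + 1
    c = h + suc j + j + 1
    c≢0 : NonZero c
    c≢0 = >-nonZero (m≤n+m 1 (h + suc j + j))
    poly₁ : ∀ b c k h p i l r → b * c * (k * h * p) + k * i * (b * l * r) ≡ k * b * (h * c * p + i * l * r)
    poly₁ = solve-∀
    poly₂ : ∀ j h q →
      2 * j * (2 * suc j + 1) * ((2 * (h + suc j) + 1) * suc j * q) + suc j * (4 * j + 6 + 3 * h) * q
      ≡ (2 * suc j + 1) * (h + suc j + j + 1) * ((2 * j + 1) * suc j * q) + 2 * j * suc j * (2 * suc j * h * q)
    poly₂ = solve-∀

  -- Induction on h = m - i runs downwards in i, starting from A_{m+1} = 0.
  scaled-upper : ∀ {m} h i → h + i ≡ m → suc i * scaled m (suc i) ≤ h * scaled m i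
  scaled-upper zero i refl =
    ≤-reflexive (trans (cong (suc i *_) (scaled-above i)) (*-zeroʳ (suc i)))
  scaled-upper {m} (suc h) i 1+h+i≡m =
    ratio-upper-step i h (scaled m i) (scaled m (1 + i)) (scaled m (2 + i)) h+1+i≡m
      (scaled-recurrence (suc h) i 1+h+i≡m) (scaled-upper h (suc i) h+1+i≡m)
    where h+1+i≡m = trans (+-suc h i) 1+h+i≡m

  scaled-lower : ∀ {m} h i → h + i ≡ m →
    2 * i * h * scaled m i ≤ (2 * i + 1) * suc i * scaled m (suc i)
  scaled-lower zero i refl = ≤-trans (≤-reflexive (cong (_* scaled i i) (*-zeroʳ (2 * i)))) z≤n
  scaled-lower {m} (suc h) i 1+h+i≡m =
    ratio-lower-step i h (scaled m i) (scaled m (1 + i)) (scaled m (2 + i)) h+1+i≡m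
      (scaled-recurrence (suc h) i 1+h+i≡m) (scaled-lower h (suc i) h+1+i≡m)
    where h+1+i≡m = trans (+-suc h i) 1+h+i≡m

  -- The upper ratio bound carries positivity from A_{i+1} down to A_i, starting at the diagonal.
  scaled-positive : ∀ {m} h i → h + i ≡ m → 0 < scaled m i
  scaled-positive zero i refl = scaled-diagonal i
  scaled-positive {m} (suc h) i 1+h+i≡m = *-cancelˡ-< (suc h) 0 _ (begin-strict
    suc h * 0                  ≡⟨ *-zeroʳ (suc h) ⟩
    0                          <⟨ scaled-positive h (suc i) (trans (+-suc h i) 1+h+i≡m) ⟩
    scaled m (suc i)           ≤⟨ m≤m+n _ _ ⟩
    suc i * scaled m (suc i)   ≤⟨ scaled-upper (suc h) i 1+h+i≡m ⟩
    suc h * scaled m i         ∎)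
    where open ≤-Reasoning

  -- Log-concavity and ratio convexity for four consecutive terms.

  module Window
    -- Here i = j + 1, m = h + i, and p, q, r, s stand for A_{i-1}, ..., A_{i+2}; only polynomial
    -- inequalities remain.
    (j h p q r s : ℕ) .{{_ : NonZero h}}
    (0<q : 0 < q)
    (recₚ : suc h * (h + suc j + j + 1) * p + suc j * suc (suc j) * r ≡ (2 * (h + suc j) + 1) * suc j * q)
    (recₛ : h * (h + suc j + suc j + 1) * q + suc (suc j) * suc (suc (suc j)) * s ≡ (2 * (h + suc j) + 1) * suc (suc j) * r)
    (upper : suc (suc j) * r ≤ h * q)
    (lower : 2 * suc j * h * q ≤ (2 * suc j + 1) * suc (suc j) * r)
    where

    private
      -- N p and S are the outer terms of the two recurrences; the bounds on r say U, V ≥ 0.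
      i g N Q R V U W S : ℕ
      i = suc j
      g = h + 2 * i + 1
      N = suc h * (h + suc j + j + 1)
      Q = h * q
      R = suc i * r
      V = Q ∸ R
      U = (2 * i + 1) * suc i * r ∸ 2 * i * h * q
      W = h * N * p
      S = suc i * suc (suc i) * s

      Q≡R+V : Q ≡ R + V
      Q≡R+V = sym (m+[n∸m]≡n upper)

      -- In Q and R the lower bound is (2i + 1) R ≥ 2 i Q, that is R ≥ 2 i V, with slack U.
      R≡U+2iV : R ≡ U + 2 * i * V
      R≡U+2iV = +-cancelʳ-≡ (2 * i * R) _ _ (begin
        R + 2 * i * R                    ≡⟨ poly₁ i r ⟩
        (2 * i + 1) * suc i * r          ≡⟨ m∸n+n≡m lower ⟨
        U + 2 * i * h * q                ≡⟨ cong (U +_) (*-assoc (2 * i) h q) ⟩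
        U + 2 * i * Q                    ≡⟨ cong (λ x → U + 2 * i * x) Q≡R+V ⟩
        U + 2 * i * (R + V)              ≡⟨ poly₂ U (2 * i) R V ⟩
        U + 2 * i * V + 2 * i * R        ∎)
        where
        open ≡-Reasoning
        poly₁ : ∀ i r → suc i * r + 2 * i * (suc i * r) ≡ (2 * i + 1) * suc i * r
        poly₁ = solve-∀
        poly₂ : ∀ u c r v → u + c * (r + v) ≡ u + c * v + c * r
        poly₂ = solve-∀

      -- The first recurrence times h, solved for p; here g = m + i + 1 and h + g = 2m + 1.
      W≡ : W ≡ i * (g * R + (h + g) * V)
      W≡ = +-cancelʳ-≡ (i * h * R) _ _ (begin
        h * N * p + i * h * R                       ≡⟨ poly₁ h N p i (suc i) r ⟩
        h * (N * p + i * suc i * r)                 ≡⟨ cong (h *_) recₚ ⟩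
        h * ((2 * (h + suc j) + 1) * i * q)         ≡⟨ poly₂ j h q ⟩
        i * (h + g) * Q                             ≡⟨ cong (i * (h + g) *_) Q≡R+V ⟩
        i * (h + g) * (R + V)                       ≡⟨ poly₃ i h g R V ⟩
        i * (g * R + (h + g) * V) + i * h * R       ∎)
        where
        open ≡-Reasoning
        poly₁ : ∀ h n p i k r → h * n * p + i * h * (k * r) ≡ h * (n * p + i * k * r)
        poly₁ = solve-∀
        poly₂ : ∀ j h q → h * ((2 * (h + suc j) + 1) * suc j * q) ≡ suc j * (h + (h + 2 * suc j + 1)) * (h * q)
        poly₂ = solve-∀
        poly₃ : ∀ i h g r v → i * (h + g) * (r + v) ≡ i * (g * r + (h + g) * v) + i * h * r
        poly₃ = solve-∀

      -- The second recurrence solved for s, as S = h R - g V.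
      gV+S≡hR : g * V + S ≡ h * R
      gV+S≡hR = +-cancelˡ-≡ (g * R) _ _ (begin
        g * R + (g * V + S)                         ≡⟨ +-assoc (g * R) (g * V) S ⟨
        g * R + g * V + S                           ≡⟨ cong (_+ S) (*-distribˡ-+ g R V) ⟨
        g * (R + V) + S                             ≡⟨ cong (λ x → g * x + S) Q≡R+V ⟨
        g * Q + S                                   ≡⟨ cong (_+ S) (poly₁ j h q) ⟩
        h * (h + suc j + suc j + 1) * q + S         ≡⟨ recₛ ⟩
        (2 * (h + suc j) + 1) * suc (suc j) * r     ≡⟨ poly₂ j h r ⟩
        g * R + h * R                               ∎)
        where
        open ≡-Reasoning
        poly₁ : ∀ j h q → (h + 2 * suc j + 1) * (h * q) ≡ h * (h + suc j + suc j + 1) * q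
        poly₁ = solve-∀
        poly₂ : ∀ j h r → (2 * (h + suc j) + 1) * suc (suc j) * r
          ≡ (h + 2 * suc j + 1) * (suc (suc j) * r) + h * (suc (suc j) * r)
        poly₂ = solve-∀

      0<Q : 0 < Q
      0<Q = *-mono-< (>-nonZero⁻¹ h) 0<q

    -- Multiplied by h² N (i + 1), the claim is h W R < N (i + 1) Q². Once W and Q are written in R
    -- and V, the difference is a polynomial with nonnegative coefficients.
    log-concave : p * r < q * q
    log-concave = *-cancelˡ-< (h * h * N * suc i) _ _ (begin-strict
      h * h * N * suc i * (p * r)
        ≡⟨ poly₁ h N (suc i) p r ⟩
      h * W * R
        ≡⟨ cong (λ x → h * x * R) W≡ ⟩
      h * (i * (g * R + (h + g) * V)) * R
        ≡⟨ +-identityʳ _ ⟨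
      h * (i * (g * R + (h + g) * V)) * R + 0
        -- Strictness comes from the share 2 i (i + 1) Q² of the difference.
        <⟨ +-monoʳ-< (h * (i * (g * R + (h + g) * V)) * R)
             (*-mono-< {0} {2 * i * suc i} z<s (*-mono-< 0<R+V 0<R+V)) ⟩
      h * (i * (g * R + (h + g) * V)) * R + 2 * i * suc i * ((R + V) * (R + V))
        ≤⟨ m≤m+n _ _ ⟩
      h * (i * (g * R + (h + g) * V)) * R + 2 * i * suc i * ((R + V) * (R + V))
        + (h * g * ((R + V) * (R + V)) + h * i * (2 * i + 1) * (R * V) + i * h * g * (V * V))
        ≡⟨ poly₂ j h R V ⟩
      N * suc i * ((R + V) * (R + V))
        ≡⟨ cong (λ x → N * suc i * (x * x)) Q≡R+V ⟨
      N * suc i * (Q * Q)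
        ≡⟨ poly₃ N (suc i) h q ⟩
      h * h * N * suc i * (q * q) ∎)
      where
      open ≤-Reasoning
      0<R+V : 0 < R + V
      0<R+V = subst (0 <_) Q≡R+V 0<Q
      poly₁ : ∀ h n k p r → h * h * n * k * (p * r) ≡ h * (h * n * p) * (k * r)
      poly₁ = solve-∀
      poly₂ : ∀ j h R V → let i = suc j; g = h + 2 * i + 1 in
        h * (i * (g * R + (h + g) * V)) * R + 2 * i * suc i * ((R + V) * (R + V))
        + (h * g * ((R + V) * (R + V)) + h * i * (2 * i + 1) * (R * V) + i * h * g * (V * V))
        ≡ suc h * (h + suc j + j + 1) * suc i * ((R + V) * (R + V))
      poly₂ = solve-∀
      poly₃ : ∀ n k h q → n * k * (h * q * (h * q)) ≡ h * h * n * k * (q * q)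
      poly₃ = solve-∀

    -- This is q/p + s/r ≥ 2 r/q without denominators. The factor c brings in W and S, and the
    -- summand (i + 1) W Q g V added to both sides allows S = h R - g V to be used without
    -- subtraction. What remains is linear in W and becomes cubic in R and V.
    ratio-convex : 2 * (p * (r * r)) ≤ q * q * r + p * (q * s)
    ratio-convex = *-cancelˡ-≤ c {{c≢0}}
      (+-cancelʳ-≤ (suc i * W * Q * (g * V)) _ _ (begin
        c * (2 * (p * (r * r))) + suc i * W * Q * (g * V)
          ≡⟨ cong₂ _+_ (poly₁ h N (suc i) (suc (suc i)) p r) (cong (λ x → suc i * W * x * (g * V)) Q≡R+V) ⟩
        2 * h * suc (suc i) * W * (R * R) + suc i * W * (R + V) * (g * V)
          ≡⟨ poly₂ j h W R V ⟩
        W * ((i + 3) * h * (R * R) + suc i * (2 * i + 1) * (R * V) + suc i * g * (V * V))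
          + suc i * W * (R + V) * (h * R)
          ≤⟨ +-monoˡ-≤ (suc i * W * (R + V) * (h * R)) (cubic R W R≡U+2iV W≡) ⟩
        N * suc i * suc (suc i) * ((R + V) * (R + V) * R) + suc i * W * (R + V) * (h * R)
          ≡⟨ cong₂ (λ x y → N * suc i * suc (suc i) * (x * x * R) + suc i * W * x * y) Q≡R+V gV+S≡hR ⟨
        N * suc i * suc (suc i) * (Q * Q * R) + suc i * W * Q * (g * V + S)
          ≡⟨ poly₃ h N (suc i) (suc (suc i)) p q r s (g * V) ⟩
        c * (q * q * r + p * (q * s)) + suc i * W * Q * (g * V) ∎))
      where
      open ≤-Reasoning
      c = h * h * N * (suc i * suc i * suc (suc i))
      N≢0 : NonZero N
      N≢0 = m*n≢0 (suc h) (h + suc j + j + 1) {{_}} {{>-nonZero (m≤n+m 1 (h + suc j + j))}}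
      c≢0 : NonZero c
      c≢0 = m*n≢0 (h * h * N) (suc i * suc i * suc (suc i)) {{m*n≢0 (h * h) N {{m*n≢0 h h}} {{N≢0}}}}
      poly₁ : ∀ h n k l p r → h * h * n * (k * k * l) * (2 * (p * (r * r)))
        ≡ 2 * h * l * (h * n * p) * (k * r * (k * r))
      poly₁ = solve-∀
      poly₂ : ∀ j h W R V → let i = suc j; g = h + 2 * i + 1 in
        2 * h * suc (suc i) * W * (R * R) + suc i * W * (R + V) * (g * V)
        ≡ W * ((i + 3) * h * (R * R) + suc i * (2 * i + 1) * (R * V) + suc i * g * (V * V))
          + suc i * W * (R + V) * (h * R)
      poly₂ = solve-∀
      poly₃ : ∀ h n k l p q r s x →
        n * k * l * (h * q * (h * q) * (k * r)) + k * (h * n * p) * (h * q) * (x + k * l * s)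
        ≡ h * h * n * (k * k * l) * (q * q * r + p * (q * s)) + k * (h * n * p) * (h * q) * x
      poly₃ = solve-∀
      -- Expanding in U and V leaves only nonnegative coefficients once i = 1 + j.
      poly₄ : ∀ j h U V → let i = suc j; g = h + 2 * i + 1; R = U + 2 * i * V in
        i * (g * R + (h + g) * V) * ((i + 3) * h * (R * R) + suc i * (2 * i + 1) * (R * V) + suc i * g * (V * V))
        + ( (12 + j * (22 + j * (12 + j * 2)) + h * (6 + j * 4 + h * 2)) * (U * U * U)
          + (78 + j * (197 + j * (175 + j * (64 + j * 8))) + h * (54 + j * (78 + j * 28) + h * (16 + j * 12))) * (U * U * V)
          + (144 + j * (468 + j * (578 + j * (334 + j * (88 + j * 8)))) + h * (138 + j * (311 + j * (233 + j * 58)) + h * (44 + j * (66 + j * 24)))) * (U * V * V)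
          + (54 + j * (225 + j * (363 + j * (284 + j * (108 + j * 16)))) + h * (90 + j * (291 + j * (349 + j * (184 + j * 36))) + h * (36 + j * (86 + j * (66 + j * 16))))) * (V * V * V))
        ≡ suc h * (h + suc j + j + 1) * suc i * suc (suc i) * ((R + V) * (R + V) * R)
      poly₄ = solve-∀
      -- R and W become variables so that both equations can be matched with `refl`, leaving
      -- polynomials in j, h, U and V.
      cubic : ∀ R W → R ≡ U + 2 * i * V → W ≡ i * (g * R + (h + g) * V) →
        W * ((i + 3) * h * (R * R) + suc i * (2 * i + 1) * (R * V) + suc i * g * (V * V))
        ≤ N * suc i * suc (suc i) * ((R + V) * (R + V) * R)
      cubic _ _ refl refl = ≤-trans (m≤m+n _ _) (≤-reflexive (poly₄ j h U V))

  -- The quartic inequality on natural numbers.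

  CrossInequality : ℕ → ℕ → ℕ → ℕ → Set
  CrossInequality p q r s =
    -- Both negative terms of q² (q² - p r) > p² (r² - q s) are moved across.
    q * q * (p * r) + p * p * (r * r) < q * q * (q * q) + p * p * (q * s)

  -- Adding the left side to both sides makes the claim the sum of p times the convexity and of 2 x
  -- y < x² + y² for x = q², y = p r; log-concavity makes the latter strict.
  crossInequality : ∀ p q r s → p * r < q * q → 2 * (p * (r * r)) ≤ q * q * r + p * (q * s) →
    CrossInequality p q r s
  crossInequality p q r s pr<qq conv = +-cancelʳ-< (q * q * (p * r) + p * p * (r * r)) _ _ (begin-strict
    q * q * (p * r) + p * p * (r * r) + (q * q * (p * r) + p * p * (r * r))
      ≡⟨ poly₁ p q r ⟩
    2 * (q * q * (p * r)) + p * (2 * (p * (r * r)))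
      ≤⟨ +-monoʳ-≤ _ (*-monoʳ-≤ p conv) ⟩
    2 * (q * q * (p * r)) + p * (q * q * r + p * (q * s))
      <⟨ +-monoˡ-< _ (amgm pr<qq) ⟩
    (q * q * (q * q) + p * r * (p * r)) + p * (q * q * r + p * (q * s))
      ≡⟨ poly₂ p q r s ⟩
    q * q * (q * q) + p * p * (q * s) + (q * q * (p * r) + p * p * (r * r)) ∎)
    where
    open ≤-Reasoning
    poly₁ : ∀ p q r → q * q * (p * r) + p * p * (r * r) + (q * q * (p * r) + p * p * (r * r))
      ≡ 2 * (q * q * (p * r)) + p * (2 * (p * (r * r)))
    poly₁ = solve-∀
    poly₂ : ∀ p q r s → (q * q * (q * q) + p * r * (p * r)) + p * (q * q * r + p * (q * s))
      ≡ q * q * (q * q) + p * p * (q * s) + (q * q * (p * r) + p * p * (r * r))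
    poly₂ = solve-∀
    amgm : ∀ {x y} → y < x → 2 * (x * y) < x * x + y * y
    -- With x = y + 1 + d, the square (x - y)² is 1 + (d² + 2d), and the 1 gives strictness.
    amgm {x} {y} y<x = subst (λ x → 2 * (x * y) < x * x + y * y) (m+[n∸m]≡n y<x)
      (≤-trans (m≤m+n _ _) (≤-reflexive (poly y (x ∸ suc y))))
      where
      poly : ∀ y d → suc (2 * ((suc y + d) * y)) + (d * d + 2 * d) ≡ (suc y + d) * (suc y + d) + y * y
      poly = solve-∀

  -- For i = j + 1 the distance m - i is `suc h`, so i ≤ m - 1 is built in and `Window` receives a
  -- nonzero argument. For h = 0 the last term is A_{m+1} = 0.
  scaled-crossInequality : ∀ {m} h j → suc h + suc j ≡ m →
    CrossInequality (scaled m j) (scaled m (1 + j)) (scaled m (2 + j)) (scaled m (3 + j))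
  scaled-crossInequality h j refl =
    crossInequality (A j) (A (1 + j)) (A (2 + j)) (A (3 + j)) log-concave ratio-convex
    where
    A = scaled (suc h + suc j)
    open Window j (suc h) (A j) (A (1 + j)) (A (2 + j)) (A (3 + j))
      (scaled-positive (suc h) (suc j) refl)
      (scaled-recurrence (suc (suc h)) j (sym (+-suc (suc h) j)))
      (scaled-recurrence (suc h) (suc j) refl)
      (scaled-upper (suc h) (suc j) refl)
      (scaled-lower (suc h) (suc j) refl)

open Naturals

-- Transfer to the rational numbers.

open import Data.Integer.Base as ℤ using (+_)
import Data.Integer.Properties as ℤ
open import Data.Rational.Base using (_*_; _-_; _>_)
open import Data.Rational.Base as ℚ using (ℚ; _/_; _<_; Positive; toℚᵘ)
import Data.Rational.Properties as ℚ
open import Data.Rational.Solver using (module +-*-Solver)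
open import Data.Rational.Unnormalised.Base as ℚᵘ using (mkℚᵘ; *≡*; *<*)
import Data.Rational.Unnormalised.Properties as ℚᵘ

fromℕ : ℕ → ℚ
fromℕ n = + n / 1

fromℕ-homo-+ : ∀ a b → fromℕ (a + b) ≡ fromℕ a ℚ.+ fromℕ b
fromℕ-homo-+ a b = ℚ.toℚᵘ-injective (begin
  toℚᵘ (fromℕ (a + b))               ≈⟨ ℚ.toℚᵘ-fromℚᵘ (mkℚᵘ (+ (a + b)) 0) ⟩
  mkℚᵘ (+ (a + b)) 0                 ≈⟨ *≡* (cong (ℤ._* + 1) (cong₂ ℤ._+_ (ℤ.*-identityʳ (+ a)) (ℤ.*-identityʳ (+ b)))) ⟨
  mkℚᵘ (+ a) 0 ℚᵘ.+ mkℚᵘ (+ b) 0       ≈⟨ ℚᵘ.+-cong (ℚ.toℚᵘ-fromℚᵘ (mkℚᵘ (+ a) 0)) (ℚ.toℚᵘ-fromℚᵘ (mkℚᵘ (+ b) 0)) ⟨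
  toℚᵘ (fromℕ a) ℚᵘ.+ toℚᵘ (fromℕ b)   ≈⟨ ℚ.toℚᵘ-homo-+ (fromℕ a) (fromℕ b) ⟨
  toℚᵘ (fromℕ a ℚ.+ fromℕ b)             ∎)
  where open ℚᵘ.≃-Reasoning

fromℕ-homo-* : ∀ a b → fromℕ (a ℕ.* b) ≡ fromℕ a * fromℕ b
fromℕ-homo-* a b = ℚ.toℚᵘ-injective (begin
  toℚᵘ (fromℕ (a ℕ.* b))               ≈⟨ ℚ.toℚᵘ-fromℚᵘ (mkℚᵘ (+ (a ℕ.* b)) 0) ⟩
  mkℚᵘ (+ (a ℕ.* b)) 0                 ≈⟨ *≡* (cong (ℤ._* + 1) (ℤ.pos-* a b)) ⟩
  mkℚᵘ (+ a) 0 ℚᵘ.* mkℚᵘ (+ b) 0       ≈⟨ ℚᵘ.*-cong (ℚ.toℚᵘ-fromℚᵘ (mkℚᵘ (+ a) 0)) (ℚ.toℚᵘ-fromℚᵘ (mkℚᵘ (+ b) 0)) ⟨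
  toℚᵘ (fromℕ a) ℚᵘ.* toℚᵘ (fromℕ b)   ≈⟨ ℚ.toℚᵘ-homo-* (fromℕ a) (fromℕ b) ⟨
  toℚᵘ (fromℕ a * fromℕ b)             ∎)
  where open ℚᵘ.≃-Reasoning

fromℕ-mono-< : ∀ {a b} → a ℕ.< b → fromℕ a < fromℕ b
fromℕ-mono-< {a} {b} a<b = ℚ.toℚᵘ-cancel-< (begin-strict
  toℚᵘ (fromℕ a)   ≃⟨ ℚ.toℚᵘ-fromℚᵘ (mkℚᵘ (+ a) 0) ⟩
  mkℚᵘ (+ a) 0     <⟨ *<* (ℤ.*-monoʳ-<-pos (+ 1) (ℤ.+<+ a<b)) ⟩
  mkℚᵘ (+ b) 0     ≃⟨ ℚ.toℚᵘ-fromℚᵘ (mkℚᵘ (+ b) 0) ⟨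
  toℚᵘ (fromℕ b)   ∎)
  where open ℚᵘ.≤-Reasoning

/-factor : ∀ a n .{{_ : NonZero n}} → + a / n ≡ fromℕ a * (+ 1 / n)
/-factor a n@(suc n-1) = ℚ.toℚᵘ-injective (begin
  toℚᵘ (+ a / n)                        ≈⟨ ℚ.toℚᵘ-fromℚᵘ (mkℚᵘ (+ a) n-1) ⟩
  mkℚᵘ (+ a) n-1                        ≈⟨ *≡* (cong₂ ℤ._*_ (sym (ℤ.*-identityʳ (+ a))) (cong +_ (ℕ.*-identityˡ n))) ⟩
  mkℚᵘ (+ a) 0 ℚᵘ.* mkℚᵘ (+ 1) n-1      ≈⟨ ℚᵘ.*-cong (ℚ.toℚᵘ-fromℚᵘ (mkℚᵘ (+ a) 0)) (ℚ.toℚᵘ-fromℚᵘ (mkℚᵘ (+ 1) n-1)) ⟨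
  toℚᵘ (fromℕ a) ℚᵘ.* toℚᵘ (+ 1 / n)    ≈⟨ ℚ.toℚᵘ-homo-* (fromℕ a) (+ 1 / n) ⟨
  toℚᵘ (fromℕ a * (+ 1 / n))            ∎)
  where open ℚᵘ.≃-Reasoning

-- Both sides are homogeneous of degree four, so the common scale c contributes only the positive
-- factor c⁴.
CrossInequality⇒< : ∀ c .{{_ : Positive c}} p q r s → CrossInequality p q r s →
  ∀ {P Q R S} → P ≡ fromℕ p * c → Q ≡ fromℕ q * c → R ≡ fromℕ r * c → S ≡ fromℕ s * c →
  P ² * (R ² - Q * S) < Q ² * (Q ² - P * R)
CrossInequality⇒< c p q r s cross refl refl refl refl = begin-strict
  (P * c) ² * ((R * c) ² - (Q * c) * (S * c))
    ≡⟨ poly₁ c P Q R S ⟩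
  (Q * Q * (P * R) ℚ.+ P * P * (R * R)) * c⁴ - t
    ≡⟨ cong (λ x → x * c⁴ - t)
         (trans (fromℕ-homo-+ (q ℕ.* q ℕ.* (p ℕ.* r)) (p ℕ.* p ℕ.* (r ℕ.* r)))
           (cong₂ ℚ._+_ (homo q q p r) (homo p p r r))) ⟨
  fromℕ (q ℕ.* q ℕ.* (p ℕ.* r) + p ℕ.* p ℕ.* (r ℕ.* r)) * c⁴ - t
    <⟨ ℚ.+-monoˡ-< (ℚ.- t) (ℚ.*-monoˡ-<-pos c⁴ {{c⁴>0}} (fromℕ-mono-< cross)) ⟩
  fromℕ (q ℕ.* q ℕ.* (q ℕ.* q) + p ℕ.* p ℕ.* (q ℕ.* s)) * c⁴ - t
    ≡⟨ cong (λ x → x * c⁴ - t)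
         (trans (fromℕ-homo-+ (q ℕ.* q ℕ.* (q ℕ.* q)) (p ℕ.* p ℕ.* (q ℕ.* s)))
           (cong₂ ℚ._+_ (homo q q q q) (homo p p q s))) ⟩
  (Q * Q * (Q * Q) ℚ.+ P * P * (Q * S)) * c⁴ - t
    ≡⟨ poly₂ c P Q R S ⟨
  (Q * c) ² * ((Q * c) ² - (P * c) * (R * c)) ∎
  where
  open ℚ.≤-Reasoning
  P = fromℕ p
  Q = fromℕ q
  R = fromℕ r
  S = fromℕ s
  c⁴ = c * c * (c * c)
  -- The terms that `CrossInequality` moved across; subtracting them restores both differences.
  t = (Q * Q * (P * R) ℚ.+ P * P * (Q * S)) * c⁴
  c⁴>0 : Positive c⁴
  c⁴>0 = ℚ.pos*pos⇒pos (c * c) {{ℚ.pos*pos⇒pos c c}} (c * c) {{ℚ.pos*pos⇒pos c c}}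
  homo : ∀ a b a′ b′ → fromℕ (a ℕ.* b ℕ.* (a′ ℕ.* b′)) ≡ fromℕ a * fromℕ b * (fromℕ a′ * fromℕ b′)
  homo a b a′ b′ = trans (fromℕ-homo-* (a ℕ.* b) (a′ ℕ.* b′))
    (cong₂ _*_ (fromℕ-homo-* a b) (fromℕ-homo-* a′ b′))
  open +-*-Solver
  poly₁ : ∀ c P Q R S → (P * c) ² * ((R * c) ² - (Q * c) * (S * c)) ≡
    (Q * Q * (P * R) ℚ.+ P * P * (R * R)) * (c * c * (c * c))
    - (Q * Q * (P * R) ℚ.+ P * P * (Q * S)) * (c * c * (c * c))
  poly₁ = solve 5 (λ c P Q R S →
    ((P :* c) :* (P :* c)) :* ((R :* c) :* (R :* c) :- (Q :* c) :* (S :* c)) :=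
    (Q :* Q :* (P :* R) :+ P :* P :* (R :* R)) :* (c :* c :* (c :* c))
    :- (Q :* Q :* (P :* R) :+ P :* P :* (Q :* S)) :* (c :* c :* (c :* c))) refl
  poly₂ : ∀ c P Q R S → (Q * c) ² * ((Q * c) ² - (P * c) * (R * c)) ≡
    (Q * Q * (Q * Q) ℚ.+ P * P * (Q * S)) * (c * c * (c * c))
    - (Q * Q * (P * R) ℚ.+ P * P * (Q * S)) * (c * c * (c * c))
  poly₂ = solve 5 (λ c P Q R S →
    ((Q :* c) :* (Q :* c)) :* ((Q :* c) :* (Q :* c) :- (P :* c) :* (R :* c)) :=
    (Q :* Q :* (Q :* Q) :+ P :* P :* (Q :* S)) :* (c :* c :* (c :* c))
    :- (Q :* Q :* (P :* R) :+ P :* P :* (Q :* S)) :* (c :* c :* (c :* c))) refl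

4^-_ : ℕ → ℚ
4^- m = (+ 1 / (2 ℕ.^ (2 ℕ.* m))) {{ℕ.m^n≢0 2 (2 ℕ.* m)}}

4^-m-positive : ∀ m → Positive (4^- m)
4^-m-positive m = ℚ.normalize-pos 1 (2 ℕ.^ (2 ℕ.* m)) {{ℕ.m^n≢0 2 (2 ℕ.* m)}}

-- The range of i reaches m + 1 because d_{i+2}(m) occurs in the theorem with i = m - 1; `suc m ∸ i`
-- is still exact there.
d≡scaled : ∀ m i → i ≤ suc m → d i m ≡ fromℕ (scaled m i) * 4^- m
d≡scaled m i i≤1+m = trans
  (cong (λ n → (+ n / (2 ℕ.^ (2 ℕ.* m))) {{ℕ.m^n≢0 2 (2 ℕ.* m)}}) (begin
    sum (applyUpTo (λ j → term m i (i + j)) (suc m ∸ i))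
      ≡⟨ sum-applyUpTo-skip (term m i) i (suc m ∸ i) (term-below m i) ⟨
    sum (applyUpTo (term m i) (i + (suc m ∸ i)))
      ≡⟨ cong (λ n → sum (applyUpTo (term m i) n)) (ℕ.m+[n∸m]≡n i≤1+m) ⟩
    scaled m i ∎))
  (/-factor (scaled m i) (2 ℕ.^ (2 ℕ.* m)) {{ℕ.m^n≢0 2 (2 ℕ.* m)}})
  where open ≡-Reasoning

theorem1p1 : ∀ (m i : ℕ) → 2 ≤ m → 1 ≤ i → i ≤ m ∸ 1 →
    d i m ² * (d i m ² - d (i ∸ 1) m * d (i + 1) m) >
    d (i ∸ 1) m ² * (d (i + 1) m ² - d i m * d (i + 2) m)
theorem1p1 (suc m) (suc j) _ _ 1+j≤m =
  CrossInequality⇒< (4^- suc m) {{4^-m-positive (suc m)}} (A j) (A (1 + j)) (A (2 + j)) (A (3 + j))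
    (scaled-crossInequality (m ∸ suc j) j (cong suc (ℕ.m∸n+n≡m 1+j≤m)))
    (d≡scaled (suc m) j (ℕ.≤-trans (ℕ.n≤1+n j) 1+j≤2+m))
    (d≡scaled (suc m) (1 + j) 1+j≤2+m)
    -- The index i + 1 of the statement is stuck on j, so it is commuted to the computing form 1 +
    -- i.
    (trans (cong (λ k → d k (suc m)) (ℕ.+-comm (suc j) 1))
      (d≡scaled (suc m) (2 + j) (ℕ.≤-trans (s≤s 1+j≤m) (ℕ.n≤1+n (suc m)))))
    (trans (cong (λ k → d k (suc m)) (ℕ.+-comm (suc j) 2))
      (d≡scaled (suc m) (3 + j) (s≤s (s≤s 1+j≤m))))
  where
  A = scaled (suc m)
  1+j≤2+m = ℕ.≤-trans 1+j≤m (ℕ.m≤n+m m 2)
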